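{- Let $A\in\mathbb{Z}^{d\times n}$, $c\in\mathbb{R}^n$, and $F(A)=\{b_1,\dots,b_k\}$. Let $z_1^{opt},\dots,z_k^{opt}$ be optimal solutions to the integer programs \[ \min\{c^\intercal z: Az=b_i,\ z\in\mathbb{Z}^n_+\},\qquad i=1,\dots,k, \] and let $b\in\mathbb{Z}^d$ be such that the problem \[ \min\{c^\intercal z: Az=b,\ z\in\mathbb{Z}^n_+\} \] is solvable. If $P^I_{A,b}=\bigoplus_{i=1}^{k}\alpha_i P^I_{A,b_i}$ with $\alpha_1,\dots,\alpha_k\in\mathbb{Z}_+$, then $\bar z:=\sum_{i=1}^k\alpha_i z_i^{opt}$ is an optimal solution to $\min\{c^\intercal z: Az=b,\ z\in\mathbb{Z}^n_+\}$.
   Context: $\mathbb{Z}_+$ denotes the nonnegative integers. For $u,v\in\mathbb{R}^n$ write $u\sqsubseteq v$ if $u^{(j)}v^{(j)}\ge 0$ and $|u^{(j)}|\le |v^{(j)}|$ for all components $j=1,\dots,n$. For $S,T,U\subseteq\mathbb{R}^n$ write $S=T\oplus U$ if for every $z\in S$ there are $z_1\in T$ and $z_2\in U$ with $z_1\sqsubseteq z$, $z_2\sqsubseteq z$ and $z=z_1+z_2$. For $A\in\mathbb{Z}^{d\times n}$ and $b\in\mathbb{Z}^d$, the fiber of $b$ is $P^I_{A,b}:=\{z\in\mathbb{Z}^n_+: Az=b\}$. The fiber $P^I_{A,b}$ is called atomic if it cannot be written as $P^I_{A,b}=P^I_{A,b_1}\oplus P^I_{A,b_2}$ with two other fibers $P^I_{A,b_1}$,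 $P^I_{A,b_2}$ (i.e. with $b_1,b_2\in\mathbb{Z}^d$, $b_1\neq b$ and $b_2\ne b$). In particular, empty fibers are not atomic, since they decompose vacuously. $F(A)$ denotes the set of right-hand sides $b$ for which $P^I_{A,b}$ is atomic; it is a known fact that $F(A)$ is finite. The notation $P^I_{A,b}=\bigoplus_{i=1}^k\alpha_iP^I_{A,b_i}$ means the iterated $\oplus$-decomposition in which $P^I_{A,b_i}$ occurs as a summand $\alpha_i$ times: every $z\in P^I_{A,b}$ can be written as $z=\sum_{i=1}^k\sum_{l=1}^{\alpha_i} z_{i,l}$ with $z_{i,l}\in P^I_{A,b_i}$ and $z_{i,l}\sqsubseteq z$ (empty sums being $0$). -}

module Defs where

open import Level using (0ℓ)
open import Algebra.Bundles.Raw using (RawMonoid)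
import Algebra.Definitions.RawMonoid as RawMonoidDefs
open import Data.Fin.Base using (Fin)
open import Data.Integer.Base as ℤ using (ℤ; 0ℤ; +_)
open import Data.Nat.Base as ℕ using (ℕ)
import Data.Nat.Properties as ℕₚ
open import Data.Product.Base using (Σ-syntax; ∃-syntax; _×_; _,_)
open import Data.Rational.Base as ℚ
  using (ℚ; 0ℚ; 1ℚ; ½; ∣_∣; Positive; NonNegative; positive; nonNegative; 1/_)
import Data.Rational.Properties as ℚₚ
open import Data.Rational.Solver using (module +-*-Solver)
open import Data.Vec.Base using (Vec; foldr′; lookup; map; replicate; zipWith)
open import Relation.Binary.PropositionalEquality
  using (_≡_; _≢_; refl; sym; trans; cong; cong₂; subst)
open import Relation.Nullary.Negation using (¬_)
open import Relation.Unary using (Pred; _∈_)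

-- Real numbers are represented by Cauchy sequences of rationals, with
-- pointwise arithmetic.  Representatives are not quotiented: two of them
-- denote the same real when each is ≤ᴿ the other.

Cauchy : (ℕ → ℚ) → Set
Cauchy x = ∀ ε → 0ℚ ℚ.< ε →
  ∃[ N ] (∀ m n → N ℕ.≤ m → N ℕ.≤ n → ∣ x m ℚ.- x n ∣ ℚ.< ε)

record ℝ : Set where
  constructor mkℝ
  field
    seq    : ℕ → ℚ
    cauchy : Cauchy seq

open ℝ public

private
  ½-pos : ∀ {ε} → 0ℚ ℚ.< ε → 0ℚ ℚ.< ½ ℚ.* ε
  ½-pos {ε} 0<ε =
    ℚₚ.positive⁻¹ (½ ℚ.* ε) {{ℚₚ.pos*pos⇒pos ½ ε {{positive 0<ε}}}}

  ½+½ : ∀ ε → ½ ℚ.* ε ℚ.+ ½ ℚ.* ε ≡ ε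
  ½+½ ε = trans (sym (ℚₚ.*-distribʳ-+ ε ½ ½)) (ℚₚ.*-identityˡ ε)

  +-cauchy : ∀ {x y} → Cauchy x → Cauchy y → Cauchy (λ n → x n ℚ.+ y n)
  +-cauchy {x} {y} cx cy ε 0<ε
    with cx (½ ℚ.* ε) (½-pos 0<ε) | cy (½ ℚ.* ε) (½-pos 0<ε)
  ... | N , p | M , q = N ℕ.⊔ M , λ m n le le′ → begin-strict
      ∣ (x m ℚ.+ y m) ℚ.- (x n ℚ.+ y n) ∣
        ≡⟨ cong ∣_∣ (rearrange (x m) (y m) (x n) (y n)) ⟩
      ∣ (x m ℚ.- x n) ℚ.+ (y m ℚ.- y n) ∣
        ≤⟨ ℚₚ.∣p+q∣≤∣p∣+∣q∣ (x m ℚ.- x n) (y m ℚ.- y n) ⟩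
      ∣ x m ℚ.- x n ∣ ℚ.+ ∣ y m ℚ.- y n ∣
        <⟨ ℚₚ.+-mono-< (p m n (ℕₚ.m⊔n≤o⇒m≤o N M le) (ℕₚ.m⊔n≤o⇒m≤o N M le′))
                       (q m n (ℕₚ.m⊔n≤o⇒n≤o N M le) (ℕₚ.m⊔n≤o⇒n≤o N M le′)) ⟩
      ½ ℚ.* ε ℚ.+ ½ ℚ.* ε
        ≡⟨ ½+½ ε ⟩
      ε ∎
    where
    open ℚₚ.≤-Reasoning
    rearrange : ∀ a b c d → (a ℚ.+ b) ℚ.- (c ℚ.+ d) ≡ (a ℚ.- c) ℚ.+ (b ℚ.- d)
    rearrange = solve 4 (λ a b c d →
      (a :+ b) :- (c :+ d) := (a :- c) :+ (b :- d)) refl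
      where open +-*-Solver

  eventuallyBounded : ∀ {x} → Cauchy x →
    ∃[ B ] Positive B × ∃[ N ] (∀ n → N ℕ.≤ n → ∣ x n ∣ ℚ.≤ B)
  eventuallyBounded {x} cx with cx 1ℚ (ℚₚ.positive⁻¹ 1ℚ)
  ... | N , p =
    1ℚ ℚ.+ ∣ x N ∣ ,
    ℚₚ.pos+nonNeg⇒pos 1ℚ ∣ x N ∣ {{nonNegative (ℚₚ.0≤∣p∣ (x N))}} ,
    N , λ n N≤n → begin
      ∣ x n ∣                        ≡⟨ cong ∣_∣ (split (x n) (x N)) ⟩
      ∣ (x n ℚ.- x N) ℚ.+ x N ∣      ≤⟨ ℚₚ.∣p+q∣≤∣p∣+∣q∣ (x n ℚ.- x N) (x N) ⟩
      ∣ x n ℚ.- x N ∣ ℚ.+ ∣ x N ∣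
        ≤⟨ ℚₚ.+-monoˡ-≤ ∣ x N ∣ (ℚₚ.<⇒≤ (p n N N≤n ℕₚ.≤-refl)) ⟩
      1ℚ ℚ.+ ∣ x N ∣                 ∎
    where
    open ℚₚ.≤-Reasoning
    split : ∀ a b → a ≡ (a ℚ.- b) ℚ.+ b
    split = solve 2 (λ a b → a := (a :- b) :+ b) refl
      where open +-*-Solver

  share : ∀ B → Positive B → ∀ {ε} → 0ℚ ℚ.< ε →
          ∃[ δ ] 0ℚ ℚ.< δ × B ℚ.* δ ≡ ½ ℚ.* ε
  share B B>0 {ε} 0<ε = B⁻¹ ℚ.* (½ ℚ.* ε)
    , ℚₚ.positive⁻¹ _ {{ℚₚ.pos*pos⇒pos B⁻¹ {{ℚₚ.1/pos⇒pos B {{B>0}}}}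
                        (½ ℚ.* ε) {{positive (½-pos 0<ε)}}}}
    , trans (sym (ℚₚ.*-assoc B B⁻¹ (½ ℚ.* ε)))
      (trans (cong (ℚ._* (½ ℚ.* ε)) (ℚₚ.*-inverseʳ B {{B≢0}}))
             (ℚₚ.*-identityˡ (½ ℚ.* ε)))
    where
    B≢0 = ℚₚ.pos⇒nonZero B {{B>0}}
    B⁻¹ = (1/ B) {{B≢0}}

  *-bound : ∀ B a d δ → Positive B → ∣ a ∣ ℚ.≤ B → ∣ d ∣ ℚ.< δ →
            ∣ a ℚ.* d ∣ ℚ.< B ℚ.* δ
  *-bound B a d δ B>0 a≤B d<δ = begin-strict
      ∣ a ℚ.* d ∣        ≡⟨ ℚₚ.∣p*q∣≡∣p∣*∣q∣ a d ⟩
      ∣ a ∣ ℚ.* ∣ d ∣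
        ≤⟨ ℚₚ.*-monoʳ-≤-nonNeg ∣ d ∣ {{nonNegative (ℚₚ.0≤∣p∣ d)}} a≤B ⟩
      B ℚ.* ∣ d ∣        <⟨ ℚₚ.*-monoʳ-<-pos B {{B>0}} d<δ ⟩
      B ℚ.* δ            ∎
    where open ℚₚ.≤-Reasoning

  *-difference : ∀ a b c d →
    a ℚ.* b ℚ.- c ℚ.* d ≡ a ℚ.* (b ℚ.- d) ℚ.+ d ℚ.* (a ℚ.- c)
  *-difference = solve 4 (λ a b c d →
    a :* b :- c :* d := a :* (b :- d) :+ d :* (a :- c)) refl
    where open +-*-Solver

  *-close : ∀ {B C δ η ε} a b c d → Positive B → Positive C →
            B ℚ.* δ ≡ ½ ℚ.* ε → C ℚ.* η ≡ ½ ℚ.* ε →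
            ∣ a ∣ ℚ.≤ B → ∣ d ∣ ℚ.≤ C → ∣ b ℚ.- d ∣ ℚ.< δ → ∣ a ℚ.- c ∣ ℚ.< η →
            ∣ a ℚ.* b ℚ.- c ℚ.* d ∣ ℚ.< ε
  *-close {B} {C} {δ} {η} {ε} a b c d B>0 C>0 Bδ Cη a≤B d≤C b-d<δ a-c<η =
    begin-strict
      ∣ a ℚ.* b ℚ.- c ℚ.* d ∣
        ≡⟨ cong ∣_∣ (*-difference a b c d) ⟩
      ∣ a ℚ.* (b ℚ.- d) ℚ.+ d ℚ.* (a ℚ.- c) ∣
        ≤⟨ ℚₚ.∣p+q∣≤∣p∣+∣q∣ (a ℚ.* (b ℚ.- d)) (d ℚ.* (a ℚ.- c)) ⟩
      ∣ a ℚ.* (b ℚ.- d) ∣ ℚ.+ ∣ d ℚ.* (a ℚ.- c) ∣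
        <⟨ ℚₚ.+-mono-< (*-bound B a (b ℚ.- d) δ B>0 a≤B b-d<δ)
                       (*-bound C d (a ℚ.- c) η C>0 d≤C a-c<η) ⟩
      B ℚ.* δ ℚ.+ C ℚ.* η
        ≡⟨ cong₂ ℚ._+_ Bδ Cη ⟩
      ½ ℚ.* ε ℚ.+ ½ ℚ.* ε
        ≡⟨ ½+½ ε ⟩
      ε ∎
    where open ℚₚ.≤-Reasoning

  *-cauchy : ∀ {x y} → Cauchy x → Cauchy y → Cauchy (λ n → x n ℚ.* y n)
  *-cauchy {x} {y} cx cy ε 0<ε = fromBounds (eventuallyBounded cx) (eventuallyBounded cy)
    where
    Goal : Set
    Goal = ∃[ N ] (∀ m n → N ℕ.≤ m → N ℕ.≤ n → ∣ x m ℚ.* y m ℚ.- x n ℚ.* y n ∣ ℚ.< ε)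

    Bounded : (ℕ → ℚ) → ℚ → Set
    Bounded u B = ∃[ N ] (∀ n → N ℕ.≤ n → ∣ u n ∣ ℚ.≤ B)

    Close : (ℕ → ℚ) → ℚ → Set
    Close u δ = ∃[ N ] (∀ m n → N ℕ.≤ m → N ℕ.≤ n → ∣ u m ℚ.- u n ∣ ℚ.< δ)

    assemble : ∀ {B C δ η} → Positive B → Positive C →
               B ℚ.* δ ≡ ½ ℚ.* ε → C ℚ.* η ≡ ½ ℚ.* ε →
               Bounded x B → Bounded y C → Close y δ → Close x η → Goal
    assemble B>0 C>0 Bδ Cη (K , x≤B) (L , y≤C) (M , q) (N , p) =
      (K ℕ.⊔ L) ℕ.⊔ (N ℕ.⊔ M) , λ m n le le′ →
      let KL≤m = ℕₚ.m⊔n≤o⇒m≤o (K ℕ.⊔ L) (N ℕ.⊔ M) le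
          KL≤n = ℕₚ.m⊔n≤o⇒m≤o (K ℕ.⊔ L) (N ℕ.⊔ M) le′
          NM≤m = ℕₚ.m⊔n≤o⇒n≤o (K ℕ.⊔ L) (N ℕ.⊔ M) le
          NM≤n = ℕₚ.m⊔n≤o⇒n≤o (K ℕ.⊔ L) (N ℕ.⊔ M) le′
      in *-close (x m) (y m) (x n) (y n) B>0 C>0 Bδ Cη
           (x≤B m (ℕₚ.m⊔n≤o⇒m≤o K L KL≤m)) (y≤C n (ℕₚ.m⊔n≤o⇒n≤o K L KL≤n))
           (q m n (ℕₚ.m⊔n≤o⇒n≤o N M NM≤m) (ℕₚ.m⊔n≤o⇒n≤o N M NM≤n))
           (p m n (ℕₚ.m⊔n≤o⇒m≤o N M NM≤m) (ℕₚ.m⊔n≤o⇒m≤o N M NM≤n))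

    fromBounds : ∃[ B ] Positive B × Bounded x B → ∃[ C ] Positive C × Bounded y C → Goal
    fromBounds (B , B>0 , bx) (C , C>0 , by) = fromShares (share B B>0 0<ε) (share C C>0 0<ε)
      where
      fromShares : ∃[ δ ] 0ℚ ℚ.< δ × B ℚ.* δ ≡ ½ ℚ.* ε →
                   ∃[ η ] 0ℚ ℚ.< η × C ℚ.* η ≡ ½ ℚ.* ε → Goal
      fromShares (δ , 0<δ , Bδ) (η , 0<η , Cη) =
        assemble B>0 C>0 Bδ Cη bx by (cy δ 0<δ) (cx η 0<η)

  const-cauchy : ∀ q → Cauchy (λ _ → q)
  const-cauchy q ε 0<ε = 0 , λ _ _ _ _ →
    subst (λ r → ∣ r ∣ ℚ.< ε) (sym (ℚₚ.+-inverseʳ q)) 0<ε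

infix  4 _≤ᴿ_
infixl 6 _+ᴿ_
infixl 7 _*ᴿ_

_+ᴿ_ : ℝ → ℝ → ℝ
x +ᴿ y = mkℝ (λ n → seq x n ℚ.+ seq y n) (+-cauchy {seq x} {seq y} (cauchy x) (cauchy y))

_*ᴿ_ : ℝ → ℝ → ℝ
x *ᴿ y = mkℝ (λ n → seq x n ℚ.* seq y n) (*-cauchy {seq x} {seq y} (cauchy x) (cauchy y))

fromℚ : ℚ → ℝ
fromℚ q = mkℝ (λ _ → q) (const-cauchy q)

fromℤ : ℤ → ℝ
fromℤ z = fromℚ (z ℚ./ 1)

0ᴿ : ℝ
0ᴿ = fromℚ 0ℚ

_≤ᴿ_ : ℝ → ℝ → Set
x ≤ᴿ y = ∀ ε → 0ℚ ℚ.< ε → ∃[ N ] (∀ n → N ℕ.≤ n → seq x n ℚ.≤ seq y n ℚ.+ ε)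

infix  4 _⊑_
infixl 6 _+ⱽ_
infixr 7 _·ⱽ_ _*ⱽ_

_+ⱽ_ : ∀ {n} → Vec ℤ n → Vec ℤ n → Vec ℤ n
_+ⱽ_ = zipWith ℤ._+_

_·ⱽ_ : ∀ {n} → ℤ → Vec ℤ n → Vec ℤ n
a ·ⱽ z = map (a ℤ.*_) z

+ⱽ-rawMonoid : ℕ → RawMonoid 0ℓ 0ℓ
+ⱽ-rawMonoid n = record
  { Carrier = Vec ℤ n ; _≈_ = _≡_ ; _∙_ = _+ⱽ_ ; ε = replicate n 0ℤ }

∑ : ∀ {n k} → (Fin k → Vec ℤ n) → Vec ℤ n
∑ {n} = RawMonoidDefs.sum (+ⱽ-rawMonoid n)

dot : ∀ {n} → Vec ℤ n → Vec ℤ n → ℤ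
dot u v = foldr′ ℤ._+_ 0ℤ (zipWith ℤ._*_ u v)

-- Matrices are given by their rows.
_*ⱽ_ : ∀ {d n} → Vec (Vec ℤ n) d → Vec ℤ n → Vec ℤ d
A *ⱽ z = map (λ row → dot row z) A

cost : ∀ {n} → Vec ℝ n → Vec ℤ n → ℝ
cost c z = foldr′ _+ᴿ_ 0ᴿ (zipWith (λ cⱼ zⱼ → cⱼ *ᴿ fromℤ zⱼ) c z)

_⊑_ : ∀ {n} → Vec ℤ n → Vec ℤ n → Set
u ⊑ v = ∀ j → 0ℤ ℤ.≤ lookup u j ℤ.* lookup v j
            × ℤ.∣ lookup u j ∣ ℕ.≤ ℤ.∣ lookup v j ∣

-- The relation written S = T ⊕ U.  It is not an equality of sets: it only
-- says that each element of S splits, and T and U may be arbitrary otherwise.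
_is_⊕_ : ∀ {n} → Pred (Vec ℤ n) 0ℓ → Pred (Vec ℤ n) 0ℓ → Pred (Vec ℤ n) 0ℓ → Set
S is T ⊕ U = ∀ z → z ∈ S →
  ∃[ z₁ ] ∃[ z₂ ] z₁ ∈ T × z₂ ∈ U × z₁ ⊑ z × z₂ ⊑ z × z ≡ z₁ +ⱽ z₂

-- The relation written S = ⨁ᵢ αᵢ Tᵢ, where Tᵢ occurs αᵢ times as a summand.
_is⨁[_]_ : ∀ {n k} → Pred (Vec ℤ n) 0ℓ → (Fin k → ℕ) → (Fin k → Pred (Vec ℤ n) 0ℓ) → Set
_is⨁[_]_ {n} S α T = ∀ z → z ∈ S →
  Σ[ w ∈ (∀ i → Fin (α i) → Vec ℤ n) ]
    (∀ i l → w i l ∈ T i × w i l ⊑ z) × z ≡ ∑ (λ i → ∑ (w i))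

Fiber : ∀ {d n} → Vec (Vec ℤ n) d → Vec ℤ d → Pred (Vec ℤ n) 0ℓ
Fiber A b z = (∀ j → 0ℤ ℤ.≤ lookup z j) × A *ⱽ z ≡ b

Atomic : ∀ {d n} → Vec (Vec ℤ n) d → Vec ℤ d → Set
Atomic A b = ¬ (∃[ b₁ ] ∃[ b₂ ] b₁ ≢ b × b₂ ≢ b × Fiber A b is Fiber A b₁ ⊕ Fiber A b₂)

F : ∀ {d n} → Vec (Vec ℤ n) d → Pred (Vec ℤ d) 0ℓ
F A b = Atomic A b

-- z is an optimal solution of min { cᵀz : Az = b, z ∈ ℤ₊ⁿ }.
Optimal : ∀ {d n} → Vec (Vec ℤ n) d → Vec ℝ n → Vec ℤ d → Vec ℤ n → Set
Optimal A c b z = z ∈ Fiber A b × (∀ w → w ∈ Fiber A b → cost c z ≤ᴿ cost c w)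

Solvable : ∀ {d n} → Vec (Vec ℤ n) d → Vec ℝ n → Vec ℤ d → Set
Solvable A c b = ∃[ z ] Optimal A c b z

{-# OPTIONS --safe #-}
-- Both A *ⱽ_ and cost c are additive, so the relations "A *ⱽ u ≡ A *ⱽ v" and
-- "cost c u ≤ᴿ cost c v" pass to sums.  Write z̄ as the sum in which zopt i
-- occurs α i times.  Any w ∈ Fiber A b splits into equally many elements of the
-- fibers of the bs i, so comparing the two sums term by term gives A *ⱽ z̄ ≡ b
-- and cost c z̄ ≤ᴿ cost c w.
module Submission where

open import Defs
open import Algebra.Bundles using (CommutativeMonoid)
import Algebra.Properties.CommutativeSemigroup as CommutativeSemigroupProperties
open import Data.Fin.Base using (Fin)
open import Data.Integer.Base as ℤ using (ℤ; 0ℤ; +_)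
import Data.Integer.Properties as ℤₚ
open import Data.Nat.Base as ℕ using (ℕ; zero; suc)
import Data.Nat.Properties as ℕₚ
open import Data.Product.Base using (∃-syntax; _,_; proj₁; proj₂)
open import Data.Rational.Base as ℚ using (ℚ; 0ℚ; ½)
import Data.Rational.Properties as ℚₚ
import Data.Rational.Unnormalised.Base as ℚᵘ
import Data.Rational.Unnormalised.Properties as ℚᵘₚ
open import Data.Vec.Base using (Vec; []; _∷_; lookup; replicate)
open import Data.Vec.Properties using (lookup-zipWith; lookup-replicate)
open import Data.Vec.Functional.Relation.Binary.Pointwise.Properties using (foldr-cong)
open import Level using (0ℓ)
open import Relation.Binary.Core using (Rel)
open import Relation.Binary.PropositionalEquality
  using (_≡_; refl; sym; trans; cong; cong₂; subst; subst₂)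
open import Relation.Unary using (_≐_)

-- `∑` is a right fold, so a relation that holds at zero and is compatible with `+ⱽ` passes to it.
-- `R` is left arbitrary because equality, nonnegativity, equality of images under `A` and
-- comparison of costs all have to pass to sums.
∑-cong : ∀ {n k} (R : Rel (Vec ℤ n) 0ℓ) → R (replicate n 0ℤ) (replicate n 0ℤ) →
         (∀ {t u v w} → R t u → R v w → R (t +ⱽ v) (u +ⱽ w)) →
         (f g : Fin k → Vec ℤ n) → (∀ i → R (f i) (g i)) → R (∑ f) (∑ g)
∑-cong R R0 R+ _ _ = foldr-cong {R = R} {S = R} R+ R0

∑∑-cong : ∀ {n k} {α : Fin k → ℕ} (R : Rel (Vec ℤ n) 0ℓ) →
          R (replicate n 0ℤ) (replicate n 0ℤ) →
          (∀ {t u v w} → R t u → R v w → R (t +ⱽ v) (u +ⱽ w)) →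
          (f g : ∀ i → Fin (α i) → Vec ℤ n) → (∀ i l → R (f i l) (g i l)) →
          R (∑ (λ i → ∑ (f i))) (∑ (λ i → ∑ (g i)))
∑∑-cong R R0 R+ f g fRg =
  ∑-cong R R0 R+ (λ i → ∑ (f i)) (λ i → ∑ (g i)) (λ i → ∑-cong R R0 R+ (f i) (g i) (fRg i))

·ⱽ-zeroˡ : ∀ {n} (z : Vec ℤ n) → 0ℤ ·ⱽ z ≡ replicate n 0ℤ
·ⱽ-zeroˡ []      = refl
·ⱽ-zeroˡ (x ∷ z) = cong₂ _∷_ (ℤₚ.*-zeroˡ x) (·ⱽ-zeroˡ z)

·ⱽ-suc : ∀ {n} a (z : Vec ℤ n) → ℤ.suc a ·ⱽ z ≡ z +ⱽ a ·ⱽ z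
·ⱽ-suc a []      = refl
·ⱽ-suc a (x ∷ z) = cong₂ _∷_ (ℤₚ.suc-* a x) (·ⱽ-suc a z)

-- Turns a scalar multiple into a sum of copies, the form that can be compared term by term with a
-- decomposition.
∑-const : ∀ {n} a (z : Vec ℤ n) → ∑ {k = a} (λ _ → z) ≡ (+ a) ·ⱽ z
∑-const zero    z = sym (·ⱽ-zeroˡ z)
∑-const (suc a) z = trans (cong (z +ⱽ_) (∑-const a z)) (sym (·ⱽ-suc (+ a) z))

NonNegⱽ : ∀ {n} → Vec ℤ n → Set
NonNegⱽ z = ∀ j → 0ℤ ℤ.≤ lookup z j

0-nonNegⱽ : ∀ {n} → NonNegⱽ (replicate n 0ℤ)
0-nonNegⱽ j = ℤₚ.≤-reflexive (sym (lookup-replicate j 0ℤ))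

+ⱽ-nonNegⱽ : ∀ {n} {u v : Vec ℤ n} → NonNegⱽ u → NonNegⱽ v → NonNegⱽ (u +ⱽ v)
+ⱽ-nonNegⱽ {u = u} {v} 0≤u 0≤v j =
  subst (0ℤ ℤ.≤_) (sym (lookup-zipWith ℤ._+_ j u v)) (ℤₚ.+-mono-≤ (0≤u j) (0≤v j))

dot-+ⱽ : ∀ {n} (r u v : Vec ℤ n) → dot r (u +ⱽ v) ≡ dot r u ℤ.+ dot r v
dot-+ⱽ []      []      []      = refl
dot-+ⱽ (a ∷ r) (x ∷ u) (y ∷ v) =
  trans (cong₂ ℤ._+_ (ℤₚ.*-distribˡ-+ a x y) (dot-+ⱽ r u v))
        (interchange (a ℤ.* x) (a ℤ.* y) (dot r u) (dot r v))
  where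
  open CommutativeSemigroupProperties
    (CommutativeMonoid.commutativeSemigroup ℤₚ.+-0-commutativeMonoid)
    using (interchange)

*ⱽ-+ⱽ : ∀ {d n} (A : Vec (Vec ℤ n) d) u v → A *ⱽ (u +ⱽ v) ≡ A *ⱽ u +ⱽ A *ⱽ v
*ⱽ-+ⱽ []      u v = refl
*ⱽ-+ⱽ (r ∷ A) u v = cong₂ _∷_ (dot-+ⱽ r u v) (*ⱽ-+ⱽ A u v)

*ⱽ-+ⱽ-cong : ∀ {d n} (A : Vec (Vec ℤ n) d) {t u v w} →
             A *ⱽ t ≡ A *ⱽ u → A *ⱽ v ≡ A *ⱽ w → A *ⱽ (t +ⱽ v) ≡ A *ⱽ (u +ⱽ w)
*ⱽ-+ⱽ-cong A {t} {u} {v} {w} p q =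
  trans (*ⱽ-+ⱽ A t v) (trans (cong₂ _+ⱽ_ p q) (sym (*ⱽ-+ⱽ A u w)))

-- Rationals are kept in lowest terms, which blocks a direct computation. Among unnormalised
-- rationals all denominators here are 1 and an integer identity remains.
/1-+ : ∀ i j → (i ℤ.+ j) ℚ./ 1 ≡ i ℚ./ 1 ℚ.+ j ℚ./ 1
/1-+ i j = ℚₚ.toℚᵘ-injective (begin
  ℚ.toℚᵘ ((i ℤ.+ j) ℚ./ 1)                ≈⟨ ℚₚ.toℚᵘ-fromℚᵘ (ℚᵘ.mkℚᵘ (i ℤ.+ j) 0) ⟩
  ℚᵘ.mkℚᵘ (i ℤ.+ j) 0                     ≈⟨ ℚᵘ.*≡* (cong (ℤ._* + 1)
                                               (sym (cong₂ ℤ._+_ (ℤₚ.*-identityʳ i) (ℤₚ.*-identityʳ j)))) ⟩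
  ℚᵘ.mkℚᵘ i 0 ℚᵘ.+ ℚᵘ.mkℚᵘ j 0            ≈⟨ ℚᵘₚ.+-cong (ℚₚ.toℚᵘ-fromℚᵘ (ℚᵘ.mkℚᵘ i 0)) (ℚₚ.toℚᵘ-fromℚᵘ (ℚᵘ.mkℚᵘ j 0)) ⟨
  ℚ.toℚᵘ (i ℚ./ 1) ℚᵘ.+ ℚ.toℚᵘ (j ℚ./ 1)  ≈⟨ ℚₚ.toℚᵘ-homo-+ (i ℚ./ 1) (j ℚ./ 1) ⟨
  ℚ.toℚᵘ (i ℚ./ 1 ℚ.+ j ℚ./ 1)            ∎)
  where open import Relation.Binary.Reasoning.Setoid ℚᵘₚ.≃-setoid

≤ᴿ-refl : ∀ x → x ≤ᴿ x
≤ᴿ-refl x ε 0<ε = 0 , λ m _ →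
  subst (ℚ._≤ seq x m ℚ.+ ε) (ℚₚ.+-identityʳ (seq x m))
        (ℚₚ.+-monoʳ-≤ (seq x m) (ℚₚ.<⇒≤ 0<ε))

≤ᴿ-resp-seq : ∀ {x x′ y y′} → (∀ m → seq x m ≡ seq x′ m) → (∀ m → seq y m ≡ seq y′ m) →
              x ≤ᴿ y → x′ ≤ᴿ y′
≤ᴿ-resp-seq x≡x′ y≡y′ x≤y ε 0<ε with x≤y ε 0<ε
... | N , p = N , λ m N≤m →
  subst₂ (λ a b → a ℚ.≤ b ℚ.+ ε) (x≡x′ m) (y≡y′ m) (p m N≤m)

+ᴿ-mono-≤ : ∀ {x y x′ y′} → x ≤ᴿ y → x′ ≤ᴿ y′ → x +ᴿ x′ ≤ᴿ y +ᴿ y′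
+ᴿ-mono-≤ {x} {y} {x′} {y′} x≤y x′≤y′ ε 0<ε = combine (x≤y δ 0<δ) (x′≤y′ δ 0<δ)
  where
  δ : ℚ
  -- Each of the two inequalities may use up half of the tolerance.
  δ = ½ ℚ.* ε

  0<δ : 0ℚ ℚ.< δ
  0<δ = ℚₚ.positive⁻¹ δ {{ℚₚ.pos*pos⇒pos ½ ε {{ℚ.positive 0<ε}}}}

  δ+δ≡ε : δ ℚ.+ δ ≡ ε
  δ+δ≡ε = trans (sym (ℚₚ.*-distribʳ-+ ε ½ ½)) (ℚₚ.*-identityˡ ε)

  open CommutativeSemigroupProperties
    (CommutativeMonoid.commutativeSemigroup ℚₚ.+-0-commutativeMonoid) using (interchange)

  combine : ∃[ N ] (∀ m → N ℕ.≤ m → seq x m ℚ.≤ seq y m ℚ.+ δ) →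
            ∃[ M ] (∀ m → M ℕ.≤ m → seq x′ m ℚ.≤ seq y′ m ℚ.+ δ) →
            ∃[ K ] (∀ m → K ℕ.≤ m → seq x m ℚ.+ seq x′ m ℚ.≤ seq y m ℚ.+ seq y′ m ℚ.+ ε)
  combine (N , p) (M , q) = N ℕ.⊔ M , λ m N⊔M≤m → begin
    seq x m ℚ.+ seq x′ m
      ≤⟨ ℚₚ.+-mono-≤ (p m (ℕₚ.m⊔n≤o⇒m≤o N M N⊔M≤m)) (q m (ℕₚ.m⊔n≤o⇒n≤o N M N⊔M≤m)) ⟩
    seq y m ℚ.+ δ ℚ.+ (seq y′ m ℚ.+ δ)
      ≡⟨ interchange (seq y m) δ (seq y′ m) δ ⟩
    seq y m ℚ.+ seq y′ m ℚ.+ (δ ℚ.+ δ)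
      ≡⟨ cong (seq y m ℚ.+ seq y′ m ℚ.+_) δ+δ≡ε ⟩
    seq y m ℚ.+ seq y′ m ℚ.+ ε ∎
    where open ℚₚ.≤-Reasoning

-- Distributivity in ℚ at each index. The equation is between sequences rather than reals, since the
-- Cauchy proofs of the two sides are built differently; `≤ᴿ-resp-seq` makes this enough for
-- comparing costs.
cost-+ⱽ : ∀ {n} (c : Vec ℝ n) u v m →
          seq (cost c (u +ⱽ v)) m ≡ seq (cost c u +ᴿ cost c v) m
cost-+ⱽ []      []      []      m = refl
cost-+ⱽ (a ∷ c) (x ∷ u) (y ∷ v) m = trans
  (cong₂ ℚ._+_ (trans (cong (seq a m ℚ.*_) (/1-+ x y))
                      (ℚₚ.*-distribˡ-+ (seq a m) (x ℚ./ 1) (y ℚ./ 1)))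
               (cost-+ⱽ c u v m))
  (interchange (seq a m ℚ.* (x ℚ./ 1)) (seq a m ℚ.* (y ℚ./ 1)) (seq (cost c u) m) (seq (cost c v) m))
  where
  open CommutativeSemigroupProperties
    (CommutativeMonoid.commutativeSemigroup ℚₚ.+-0-commutativeMonoid) using (interchange)

cost-+ⱽ-mono : ∀ {n} (c : Vec ℝ n) {t u v w} →
               cost c t ≤ᴿ cost c u → cost c v ≤ᴿ cost c w →
               cost c (t +ⱽ v) ≤ᴿ cost c (u +ⱽ w)
cost-+ⱽ-mono c {t} {u} {v} {w} t≤u v≤w =
  ≤ᴿ-resp-seq {cost c t +ᴿ cost c v} {cost c (t +ⱽ v)} {cost c u +ᴿ cost c w} {cost c (u +ⱽ w)}
    (λ m → sym (cost-+ⱽ c t v m)) (λ m → sym (cost-+ⱽ c u w m))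
    (+ᴿ-mono-≤ {cost c t} {cost c u} {cost c v} {cost c w} t≤u v≤w)

cost-∑∑-mono : ∀ {n k} (c : Vec ℝ n) {α : Fin k → ℕ} (f g : ∀ i → Fin (α i) → Vec ℤ n) →
               (∀ i l → cost c (f i l) ≤ᴿ cost c (g i l)) →
               cost c (∑ (λ i → ∑ (f i))) ≤ᴿ cost c (∑ (λ i → ∑ (g i)))
cost-∑∑-mono c = ∑∑-cong (λ u v → cost c u ≤ᴿ cost c v)
  (≤ᴿ-refl (cost c (replicate _ 0ℤ)))
  (λ {t} {u} {v} {w} → cost-+ⱽ-mono c {t} {u} {v} {w})

lemma3p2 : ∀ {d n k : ℕ}
    (A : Vec (Vec ℤ n) d) (c : Vec ℝ n)
    (bs : Fin k → Vec ℤ d) → F A ≐ (λ v → ∃[ i ] v ≡ bs i) →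
    (zopt : Fin k → Vec ℤ n) → (∀ i → Optimal A c (bs i) (zopt i)) →
    (b : Vec ℤ d) → Solvable A c b →
    (α : Fin k → ℕ) → Fiber A b is⨁[ α ] (λ i → Fiber A (bs i)) →
    Optimal A c b (∑ (λ i → (+ α i) ·ⱽ zopt i))
lemma3p2 {n = n} A c bs _ zopt opt b (z₀ , z₀∈P , _) α decompose =
  subst (Optimal A c b) z̄≡ ((z̄≥0 , Az̄≡b) , z̄-minimal)
  where
  -- Constant in the second index, to match the shape of the families that `decompose` returns.
  copies : ∀ i → Fin (α i) → Vec ℤ n
  copies i _ = zopt i

  z̄ : Vec ℤ n
  z̄ = ∑ (λ i → ∑ (copies i))

  z̄≡ : z̄ ≡ ∑ (λ i → (+ α i) ·ⱽ zopt i)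
  z̄≡ = ∑-cong _≡_ refl (cong₂ _+ⱽ_) (λ i → ∑ (copies i)) (λ i → (+ α i) ·ⱽ zopt i)
    (λ i → ∑-const (α i) (zopt i))

  z̄≥0 : NonNegⱽ z̄
  -- A predicate is treated as a relation that ignores its second argument, so `copies` can fill
  -- both places.
  z̄≥0 = ∑∑-cong (λ u _ → NonNegⱽ u) 0-nonNegⱽ
    (λ {t} {_} {v} → +ⱽ-nonNegⱽ {u = t} {v}) copies copies (λ i _ → proj₁ (proj₁ (opt i)))

  Az̄≡b : A *ⱽ z̄ ≡ b
  Az̄≡b =
    -- `decompose` says something about `b` only once the fiber has an element; solvability supplies
    -- `z₀`. Its parts have the same images under `A` as the copies, whence `z̄` and `z₀` have the
    -- same image.
    let w , w∈P , z₀≡∑w = decompose z₀ z₀∈P in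
    trans (∑∑-cong (λ u v → A *ⱽ u ≡ A *ⱽ v) refl
             (λ {t} {u} {v} {w} → *ⱽ-+ⱽ-cong A {t} {u} {v} {w}) copies w
             (λ i l → trans (proj₂ (proj₁ (opt i))) (sym (proj₂ (proj₁ (w∈P i l))))))
          (trans (cong (A *ⱽ_) (sym z₀≡∑w)) (proj₂ z₀∈P))

  z̄-minimal : ∀ z → Fiber A b z → cost c z̄ ≤ᴿ cost c z
  z̄-minimal z z∈P =
    -- The parts depend on `z` but the multiplicities `α i` do not, so the one vector `z̄` can be
    -- matched with every competitor.
    let w , w∈P , z≡∑w = decompose z z∈P in
    subst (λ v → cost c z̄ ≤ᴿ cost c v) (sym z≡∑w)
      (cost-∑∑-mono c copies w (λ i l → proj₂ (opt i) (w i l) (proj₁ (w∈P i l))))
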